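{- Let $n,k$ and $t$ be positive integers with $n\geq 2k$ and $t\geq 2$. If $\mathscr{A}_1,\mathscr{A}_2,\dots,\mathscr{A}_t\subseteq \binom{[n]}{k}$ are non-empty cross-intersecting families, then $$\sum_{i=1}^t|\mathscr{A}_i|\leq \max\left\{\binom{n}{k}-\binom{n-k}{k}+t-1,\ t\binom{n-1}{k-1}\right\},$$ and the upper bound is sharp, i.e. for all such $n,k,t$ there exist non-empty cross-intersecting families $\mathscr{A}_1,\dots,\mathscr{A}_t\subseteq\binom{[n]}{k}$ for which equality holds.
   Context: $[n]=\{1,2,\dots,n\}$, and $\binom{[n]}{k}$ denotes the collection of all $k$-element subsets of $[n]$. Families $\mathscr{A}_1,\dots,\mathscr{A}_t$ ($t\ge 2$) of subsets of $[n]$ are called cross-intersecting if $A_i\cap A_j\neq\emptyset$ for all $A_i\in\mathscr{A}_i$ and $A_j\in\mathscr{A}_j$ with $i\neq j$. "Non-empty" means that each $\mathscr{A}_i$ is a non-empty family. -}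

module Defs where

open import Algebra.Properties.CommutativeMonoid.Sum using (sum-syntax)
open import Data.Fin using (Fin)
open import Data.Fin.Subset using (Subset; ∣_∣; _∩_; Nonempty)
open import Data.List using (List; length)
open import Data.List.Membership.Propositional using (_∈_)
open import Data.List.Relation.Unary.All using (All)
open import Data.List.Relation.Unary.Unique.Propositional using (Unique)
open import Data.Nat using (ℕ; _+_; _*_; _∸_; _⊔_)
open import Data.Nat.Combinatorics using (_C_)
open import Data.Nat.Properties using (+-0-commutativeMonoid)
open import Data.Product using (∃-syntax)
open import Relation.Binary.PropositionalEquality using (_≡_; _≢_)

-- The ground set [n] is represented by Fin n.  A subfamily of ([n] choose k) is a
-- duplicate-free list of k-element subsets, so its cardinality is the length of the list.
record Family (n k : ℕ) : Set where
  field
    members : List (Subset n)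
    unique  : Unique members
    uniform : All (λ A → ∣ A ∣ ≡ k) members

open Family public

infix 4 _∈ᶠ_

_∈ᶠ_ : ∀ {n k} → Subset n → Family n k → Set
A ∈ᶠ 𝒜 = A ∈ members 𝒜

card : ∀ {n k} → Family n k → ℕ
card 𝒜 = length (members 𝒜)

NonEmpty : ∀ {n k} → Family n k → Set
NonEmpty 𝒜 = ∃[ A ] A ∈ᶠ 𝒜

-- Distinct indices may carry the same family; no condition is imposed within one family.
CrossIntersecting : ∀ {n k t} → (Fin t → Family n k) → Set
CrossIntersecting 𝒜 =
  ∀ {i j A B} → i ≢ j → A ∈ᶠ 𝒜 i → B ∈ᶠ 𝒜 j → Nonempty (A ∩ B)

totalCard : ∀ {n k t} → (Fin t → Family n k) → ℕ
totalCard {t = t} 𝒜 = sum-syntax +-0-commutativeMonoid t (λ i → card (𝒜 i))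

-- When 1 ≤ k ≤ n and 1 ≤ t no truncated subtraction below actually truncates,
-- since (n ∸ k) C k ≤ n C k.
bound : ℕ → ℕ → ℕ → ℕ
bound n k t = (n C k ∸ (n ∸ k) C k + (t ∸ 1)) ⊔ (t * ((n ∸ 1) C (k ∸ 1)))

{-# OPTIONS --safe #-}

-- Write Y = C(n-1,k-1), V = C(n-k,k) and W = C(n-1,k), so that C(n,k) = Y + W. The heart of the
-- matter is a linear form of the Kruskal–Katona theorem: if 1 ≤ |ℬ| ≤ Y, then the number of
-- k-sets disjoint from some member of ℬ is at least the linear function of |ℬ| that takes the
-- value V at |ℬ| = 1 and W at |ℬ| = Y. Passing to complements, this bounds from below the
-- upper shadow of ℬ at level n-k. For arbitrary levels l ≤ κ it follows by induction on the
-- ground set: after compressing a point away, split ℬ and its upper shadow by that point into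
-- ℬ₀, ℬ₁ and 𝒟₀, 𝒟₁. The bounds for ℬ₀ at levels κ and κ-1 of the smaller ground set add up to
-- the required one, provided ℬ₀ is large relative to ℬ₁; and it is, because compression makes
-- ℬ₀ contain the upper shadow of ℬ₁ one level up, to which the induction hypothesis applies.
--
-- If no |𝒜ᵢ| exceeds Y, the sum is at most tY. Otherwise |𝒜ᵢ| > Y for some i, and the linear
-- bound, applied to each 𝒜ⱼ with j ≠ i against 𝒜ᵢ, bounds the sum by a linear function of |𝒜ᵢ|
-- on the interval from Y to Y + W - V, hence by the larger of its values at the two ends.

module Submission where

open import Defs
import Algebra.Properties.CommutativeMonoid.Sum
open import Data.Bool as Bool using (Bool; true; false; T; not; _∧_; _∨_; if_then_else_)
open import Data.Bool.Properties using (T-∧; T-∨; ∨-inverseʳ; ∧-inverseˡ)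
open import Data.Empty using (⊥-elim)
open import Data.Fin using (Fin; zero; suc; punchIn)
open import Data.Fin.Properties using (any?; punchInᵢ≢i)
open import Data.Fin.Subset using (Subset; Side; inside; outside; ∣_∣; _⊆_; ∁; _∩_; Nonempty)
open import Data.Fin.Subset.Properties
  using (drop-∷-⊆; s⊆s; out⊆; in⊆in; p⊆q⇒∣p∣≤∣q∣; ⊆-refl; ∣p∣≤n; ∣∁p∣≡n∸∣p∣; x∈p∩q⁻; x∈∁p⇒x∉p; ∩-comm)
open import Data.List using (List; []; _∷_; _++_; map; length; allFin)
import Data.List.Membership.DecPropositional as DecMembership
open import Data.List.Membership.Propositional using () renaming (_∈_ to _∈ˡ_)
open import Data.List.Membership.Propositional.Properties
  using (∈-allFin; ∈-++⁺ˡ; ∈-++⁺ʳ; ∈-++⁻; ∈-map⁺; ∈-map⁻)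
open import Data.List.Membership.Propositional.Properties.WithK using (unique∧set⇒bag)
open import Data.List.Properties using (length-++; length-map)
open import Data.List.Relation.Binary.BagAndSetEquality using (∼bag⇒↭)
open import Data.List.Relation.Binary.Permutation.Propositional.Properties using (↭-length)
open import Data.List.Relation.Unary.All as All using ([]; _∷_)
open import Data.List.Relation.Unary.AllPairs using ([]; _∷_)
open import Data.List.Relation.Unary.Any using () renaming (here to hereˡ; there to thereˡ)
open import Data.List.Relation.Unary.Unique.Propositional using (Unique)
import Data.List.Relation.Unary.Unique.Propositional.Properties as Unique
open import Data.Nat
  using (ℕ; zero; suc; _+_; _*_; _∸_; _⊔_; _≤_; _<_; _<?_; z≤n; s≤s; s≤s⁻¹; >-nonZero)
open import Data.Nat.Combinatorics
  using (_C_; nCk+nC[k+1]≡[n+1]C[k+1]; nCk≡nC[n∸k]; nCn≡1; nC1≡n; k>n⇒nCk≡0)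
open import Data.Nat.Properties
open import Data.Nat.Tactic.RingSolver using (solve-∀)
open import Data.Product using (Σ-syntax; ∃-syntax; _×_; _,_; proj₁; proj₂)
open import Data.Sum as Sum using (_⊎_; inj₁; inj₂; [_,_]′)
open import Data.Vec using ([]; _∷_; head; tail; lookup; _[_]≔_; here; there)
open import Data.Vec.Properties using (≡-dec; ∷-injectiveʳ)
open import Function using (_∘_; const)
open import Function.Bundles using (module Equivalence; mk⇔)
open import Relation.Binary.PropositionalEquality
open import Relation.Nullary using (yes; no; ¬_)
open import Relation.Nullary.Decidable using (toWitness; fromWitness; ⌊_⌋)

open Algebra.Properties.CommutativeMonoid.Sum +-0-commutativeMonoid using (sum; sum-cong-≗; sum-remove)

-- Counting the members of a family by size

SetFamily : ℕ → Set
SetFamily n = Subset n → Bool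

private variable
  m n k : ℕ

-- A family may mix sizes; only its sets of size `l` are counted. The recursion follows Pascal's
-- rule, so that splitting by the head point holds by definition.
count : ℕ → SetFamily n → ℕ
count {zero}  zero    f = if f [] then 1 else 0
count {zero}  (suc l) f = 0
count {suc n} zero    f = count zero (f ∘ (outside ∷_))
count {suc n} (suc l) f = count (suc l) (f ∘ (outside ∷_)) + count l (f ∘ (inside ∷_))

count-cong : ∀ l {f g : SetFamily n} → (∀ v → f v ≡ g v) → count l f ≡ count l g
count-cong {zero}  zero    eq = cong (if_then 1 else 0) (eq [])
count-cong {zero}  (suc l) eq = refl
count-cong {suc n} zero    eq = count-cong zero (eq ∘ (outside ∷_))
count-cong {suc n} (suc l) eq =
  cong₂ _+_ (count-cong (suc l) (eq ∘ (outside ∷_))) (count-cong l (eq ∘ (inside ∷_)))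

count-mono : ∀ l {f g : SetFamily n} → (∀ v → ∣ v ∣ ≡ l → T (f v) → T (g v)) → count l f ≤ count l g
count-mono {zero} zero {f} {g} f⇒g with f [] | g [] | f⇒g [] refl
... | false | _     | _ = z≤n
... | true  | true  | _ = ≤-refl
... | true  | false | e = ⊥-elim (e _)
count-mono {zero}  (suc l) f⇒g = z≤n
count-mono {suc n} zero    f⇒g = count-mono zero (f⇒g ∘ (outside ∷_))
count-mono {suc n} (suc l) f⇒g =
  +-mono-≤ (count-mono (suc l) (f⇒g ∘ (outside ∷_))) (count-mono l (λ v e → f⇒g (inside ∷ v) (cong suc e)))

count-const-true : ∀ n l → count {n} l (const true) ≡ n C l
count-const-true zero    zero    = refl
count-const-true zero    (suc l) = refl
count-const-true (suc n) zero    = count-const-true n zero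
count-const-true (suc n) (suc l) =
  trans (cong₂ _+_ (count-const-true n (suc l)) (count-const-true n l))
    (trans (+-comm (n C suc l) (n C l)) (nCk+nC[k+1]≡[n+1]C[k+1] n l))

interchange : ∀ a b c d → (a + b) + (c + d) ≡ (a + c) + (b + d)
interchange = solve-∀

-- Inclusion-exclusion. The arguments of the conjunction come in the order that `shift` produces, so
-- that it applies to compressions directly.
count-∨-∧ : ∀ l (f g : SetFamily n) →
  count l (λ v → f v ∨ g v) + count l (λ v → g v ∧ f v) ≡ count l f + count l g
count-∨-∧ {zero} zero f g with f [] | g []
... | true  | true  = refl
... | true  | false = refl
... | false | true  = refl
... | false | false = refl
count-∨-∧ {zero}  (suc l) f g = refl
count-∨-∧ {suc n} zero    f g = count-∨-∧ zero (f ∘ (outside ∷_)) (g ∘ (outside ∷_))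
count-∨-∧ {suc n} (suc l) f g = begin
  (a + b) + (c + d)  ≡⟨ interchange a b c d ⟩
  (a + c) + (b + d)  ≡⟨ cong₂ _+_ (count-∨-∧ (suc l) (f ∘ (outside ∷_)) (g ∘ (outside ∷_)))
                                  (count-∨-∧ l (f ∘ (inside ∷_)) (g ∘ (inside ∷_))) ⟩
  _                  ≡⟨ interchange (count (suc l) (f ∘ (outside ∷_))) _ _ _ ⟩
  count (suc l) f + count (suc l) g ∎
  where
  open ≡-Reasoning
  a b c d : ℕ
  a = count (suc l) (λ v → f (outside ∷ v) ∨ g (outside ∷ v))
  b = count l (λ v → f (inside ∷ v) ∨ g (inside ∷ v))
  c = count (suc l) (λ v → g (outside ∷ v) ∧ f (outside ∷ v))
  d = count l (λ v → g (inside ∷ v) ∧ f (inside ∷ v))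

-- Compression away from the head point

slice : SetFamily (suc (suc m)) → Side → SetFamily (suc m)
slice f y u = f (head u ∷ y ∷ tail u)

-- Pascal's rule along the second point: the head takes part in every compression, so it cannot be
-- the point that is split off.
count-slice : ∀ l (f : SetFamily (suc (suc m))) →
  count (suc l) f ≡ count (suc l) (slice f outside) + count l (slice f inside)
count-slice zero    f = eq (count 1 (λ v → f (outside ∷ outside ∷ v))) _ _
  where
  eq : ∀ a b c → (a + b) + c ≡ (a + c) + b
  eq = solve-∀
count-slice (suc l) f = interchange (count (suc (suc l)) (λ v → f (outside ∷ outside ∷ v))) _ _ _

-- The compression replacing the head point of a set by the point i of its tail, unless the
-- result is already in the family.
shift : Fin m → SetFamily (suc m) → SetFamily (suc m)
shift zero    f (outside ∷ outside ∷ v) = f (outside ∷ outside ∷ v)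
shift zero    f (outside ∷ inside  ∷ v) = f (outside ∷ inside ∷ v) ∨ f (inside ∷ outside ∷ v)
shift zero    f (inside  ∷ outside ∷ v) = f (inside ∷ outside ∷ v) ∧ f (outside ∷ inside ∷ v)
shift zero    f (inside  ∷ inside  ∷ v) = f (inside ∷ inside ∷ v)
shift (suc i) f (x ∷ y ∷ v)             = shift i (slice f y) (x ∷ v)

slice-shift : ∀ (i : Fin m) f y u → slice (shift (suc i) f) y u ≡ shift i (slice f y) u
slice-shift i f y (x ∷ v) = refl

-- Only sets containing exactly one of the two exchanged points are affected. They form two
-- families, with the one point or the other, which are replaced by their union and intersection.
count-shift : ∀ l (i : Fin m) f → count l (shift i f) ≡ count l f
count-shift zero          zero    f = refl
count-shift (suc zero)    zero    f = trans (+-assoc a _ _)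
    (trans (cong (a +_) (count-∨-∧ 0 (λ v → f (outside ∷ inside ∷ v)) (λ v → f (inside ∷ outside ∷ v))))
      (sym (+-assoc a _ _)))
  where
  a : ℕ
  a = count 1 (λ v → f (outside ∷ outside ∷ v))
count-shift (suc (suc l)) zero    f = trans (eq a _ _ d)
    (trans (cong (λ z → a + z + d)
        (count-∨-∧ (suc l) (λ v → f (outside ∷ inside ∷ v)) (λ v → f (inside ∷ outside ∷ v))))
      (sym (eq a _ _ d)))
  where
  a d : ℕ
  a = count (suc (suc l)) (λ v → f (outside ∷ outside ∷ v))
  d = count l (λ v → f (inside ∷ inside ∷ v))
  eq : ∀ a b c d → (a + b) + (c + d) ≡ a + (b + c) + d
  eq = solve-∀
count-shift {suc m} zero    (suc i) f =
  count-shift zero i (slice f outside)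
count-shift (suc l) (suc i) f = begin
  count (suc l) (shift (suc i) f)
    ≡⟨ count-slice l (shift (suc i) f) ⟩
  count (suc l) (slice (shift (suc i) f) outside) + count l (slice (shift (suc i) f) inside)
    ≡⟨ cong₂ _+_ (part (suc l) outside) (part l inside) ⟩
  count (suc l) (slice f outside) + count l (slice f inside)
    ≡⟨ count-slice l f ⟨
  count (suc l) f ∎
  where
  open ≡-Reasoning
  part : ∀ l y → count l (slice (shift (suc i) f) y) ≡ count l (slice f y)
  part l y = trans (count-cong l (slice-shift i f y)) (count-shift l i (slice f y))

-- P restricts the pairs b ⊆ d by their sizes; it is left arbitrary because passing to a slice
-- changes the sizes.
Covers : (ℕ → ℕ → Set) → SetFamily n → SetFamily n → Set
Covers P f g = ∀ b d → b ⊆ d → P ∣ b ∣ ∣ d ∣ → T (f b) → T (g d)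

bump : Side → ℕ → ℕ
bump inside  = suc
bump outside s = s

∣x∷y∷v∣ : ∀ x y (v : Subset n) → ∣ x ∷ y ∷ v ∣ ≡ bump y ∣ x ∷ v ∣
∣x∷y∷v∣ inside  inside  v = refl
∣x∷y∷v∣ inside  outside v = refl
∣x∷y∷v∣ outside inside  v = refl
∣x∷y∷v∣ outside outside v = refl

in⊈out : ∀ {p q : Subset n} {A : Set} → (inside ∷ p) ⊆ (outside ∷ q) → A
in⊈out p⊆q with () ← p⊆q here

drop-second-⊆ : ∀ {x x' y y'} {p q : Subset n} → (x ∷ y ∷ p) ⊆ (x' ∷ y' ∷ q) → (x ∷ p) ⊆ (x' ∷ q)
drop-second-⊆ h here       with here ← h here                        = here
drop-second-⊆ h (there j∈) with there (there j∈q) ← h (there (there j∈)) = there j∈q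

insert-second-⊆ : ∀ {x x' y y'} {p q r s : Subset n} → (y ∷ p) ⊆ (y' ∷ q) → (x ∷ r) ⊆ (x' ∷ s) →
  (x ∷ y ∷ r) ⊆ (x' ∷ y' ∷ s)
insert-second-⊆ g h here               with here ← h here            = here
insert-second-⊆ g h (there here)       with here ← g here            = there here
insert-second-⊆ g h (there (there j∈)) with there j∈s ← h (there j∈) = there (there j∈s)

-- Exchanging the two points in both `b` and `d` preserves inclusion and sizes. Each membership
-- required of the compressed `g` then comes from `f⇒g`, applied to the pair itself or to the
-- exchanged pair.
shift-Covers : ∀ {P} (i : Fin m) {f g} → Covers P f g → Covers P (shift i f) (shift i g)
shift-Covers {P = P} zero {f} {g} f⇒g b d = go b d
  where
  open Equivalence
  go : Covers P (shift zero f) (shift zero g)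
  go (inside  ∷ _ ∷ p)       (outside ∷ _ ∷ q)       b⊆d s t = in⊈out b⊆d
  go (outside ∷ inside ∷ p)  (_ ∷ outside ∷ q)       b⊆d s t = in⊈out (drop-∷-⊆ b⊆d)
  go (inside ∷ inside ∷ p)   (_ ∷ outside ∷ q)       b⊆d s t = in⊈out (drop-∷-⊆ b⊆d)
  go (outside ∷ outside ∷ p) (outside ∷ outside ∷ q) b⊆d s t = f⇒g _ _ b⊆d s t
  go (outside ∷ outside ∷ p) (outside ∷ inside ∷ q)  b⊆d s t = from T-∨ (inj₁ (f⇒g _ _ b⊆d s t))
  go (outside ∷ outside ∷ p) (inside ∷ outside ∷ q)  b⊆d s t =
    from T-∧ (f⇒g _ _ b⊆d s t , f⇒g _ _ (s⊆s (out⊆ (drop-∷-⊆ (drop-∷-⊆ b⊆d)))) s t)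
  go (outside ∷ outside ∷ p) (inside ∷ inside ∷ q)   b⊆d s t = f⇒g _ _ b⊆d s t
  go (outside ∷ inside ∷ p)  (outside ∷ inside ∷ q)  b⊆d s t =
    from T-∨ (Sum.map (f⇒g _ _ b⊆d s) (f⇒g _ _ (in⊆in (out⊆ (drop-∷-⊆ (drop-∷-⊆ b⊆d)))) s) (to T-∨ t))
  go (outside ∷ inside ∷ p)  (inside ∷ inside ∷ q)   b⊆d s t =
    [ f⇒g _ _ b⊆d s , f⇒g _ _ (in⊆in (out⊆ (drop-∷-⊆ (drop-∷-⊆ b⊆d)))) s ]′ (to T-∨ t)
  go (inside ∷ outside ∷ p)  (inside ∷ outside ∷ q)  b⊆d s t =
    let t₁ , t₂ = to T-∧ t in
    from T-∧ (f⇒g _ _ b⊆d s t₁ , f⇒g _ _ (out⊆ (in⊆in (drop-∷-⊆ (drop-∷-⊆ b⊆d)))) s t₂)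
  go (inside ∷ outside ∷ p)  (inside ∷ inside ∷ q)   b⊆d s t = f⇒g _ _ b⊆d s (proj₁ (to T-∧ t))
  go (inside ∷ inside ∷ p)   (inside ∷ inside ∷ q)   b⊆d s t = f⇒g _ _ b⊆d s t
shift-Covers {P = P} (suc i) {f} {g} f⇒g (x ∷ y ∷ p) (x' ∷ y' ∷ q) b⊆d s t =
  shift-Covers {P = λ s t → P (bump y s) (bump y' t)} i {slice f y} {slice g y'} sliced
    (x ∷ p) (x' ∷ q) (drop-second-⊆ b⊆d) (subst₂ P (∣x∷y∷v∣ x y p) (∣x∷y∷v∣ x' y' q) s) t
  where
  sliced : Covers (λ s t → P (bump y s) (bump y' t)) (slice f y) (slice g y')
  sliced (z ∷ r) (z' ∷ r') h s t = f⇒g _ _ (insert-second-⊆ (drop-∷-⊆ b⊆d) h)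
    (subst₂ P (sym (∣x∷y∷v∣ z y r)) (sym (∣x∷y∷v∣ z' y' r')) s) t

Stable : Fin m → SetFamily (suc m) → Set
Stable i f = ∀ v → lookup v i ≡ outside → T (f (inside ∷ v)) → T (f (outside ∷ v [ i ]≔ inside))

shift-out-increasing : ∀ (i : Fin m) f v → T (f (outside ∷ v)) → T (shift i f (outside ∷ v))
shift-out-increasing zero    f (outside ∷ v) t = t
shift-out-increasing zero    f (inside ∷ v)  t = Equivalence.from T-∨ (inj₁ t)
shift-out-increasing (suc i) f (y ∷ v)       t = shift-out-increasing i (slice f y) v t

shift-in-decreasing : ∀ (i : Fin m) f v → T (shift i f (inside ∷ v)) → T (f (inside ∷ v))
shift-in-decreasing zero    f (outside ∷ v) t = proj₁ (Equivalence.to T-∧ t)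
shift-in-decreasing zero    f (inside ∷ v)  t = t
shift-in-decreasing (suc i) f (y ∷ v)       t = shift-in-decreasing i (slice f y) v t

shift-stable : ∀ (i : Fin m) f → Stable i (shift i f)
shift-stable zero    f (outside ∷ v) eq t =
  Equivalence.from T-∨ (inj₁ (proj₂ (Equivalence.to (T-∧ {f (inside ∷ outside ∷ v)}) t)))
shift-stable (suc i) f (y ∷ v)       eq t = shift-stable i (slice f y) v eq t

shift-preserves-Stable : ∀ (i j : Fin m) f → Stable j f → Stable j (shift i f)
shift-preserves-Stable i j f st v eq t =
  shift-out-increasing i f _ (st v eq (shift-in-decreasing i f v t))

-- One pass over all i suffices: a shift only removes sets containing the head point and only
-- adds sets avoiding it, so it cannot destroy stability at another point.
shiftAll : List (Fin m) → SetFamily (suc m) → SetFamily (suc m)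
shiftAll []       f = f
shiftAll (i ∷ is) f = shift i (shiftAll is f)

count-shiftAll : ∀ l (is : List (Fin m)) f → count l (shiftAll is f) ≡ count l f
count-shiftAll l []       f = refl
count-shiftAll l (i ∷ is) f = trans (count-shift l i _) (count-shiftAll l is f)

shiftAll-Covers : ∀ {P} (is : List (Fin m)) {f g} → Covers P f g → Covers P (shiftAll is f) (shiftAll is g)
shiftAll-Covers          []       c = c
shiftAll-Covers {P = P} (i ∷ is) c = shift-Covers {P = P} i (shiftAll-Covers {P = P} is c)

shiftAll-stable : ∀ (is : List (Fin m)) f {i} → i ∈ˡ is → Stable i (shiftAll is f)
shiftAll-stable (i ∷ is) f (hereˡ refl) = shift-stable i (shiftAll is f)
shiftAll-stable (i ∷ is) f {j} (thereˡ j∈) = shift-preserves-Stable i j _ (shiftAll-stable is f j∈)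

⊆∧∣∣≡⇒≡ : ∀ (b d : Subset n) → b ⊆ d → ∣ b ∣ ≡ ∣ d ∣ → b ≡ d
⊆∧∣∣≡⇒≡ []            []            _   _  = refl
⊆∧∣∣≡⇒≡ (inside ∷ b)  (inside ∷ d)  b⊆d eq = cong (inside ∷_) (⊆∧∣∣≡⇒≡ b d (drop-∷-⊆ b⊆d) (suc-injective eq))
⊆∧∣∣≡⇒≡ (inside ∷ b)  (outside ∷ d) b⊆d eq = in⊈out b⊆d
⊆∧∣∣≡⇒≡ (outside ∷ b) (inside ∷ d)  b⊆d eq = ⊥-elim (<⇒≢ (s≤s (p⊆q⇒∣p∣≤∣q∣ (drop-∷-⊆ b⊆d))) eq)
⊆∧∣∣≡⇒≡ (outside ∷ b) (outside ∷ d) b⊆d eq = cong (outside ∷_) (⊆∧∣∣≡⇒≡ b d (drop-∷-⊆ b⊆d) eq)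

⊆∧∣∣≡1+⇒≔ : ∀ (b d : Subset n) → b ⊆ d → ∣ d ∣ ≡ suc ∣ b ∣ →
  ∃[ i ] lookup b i ≡ outside × d ≡ b [ i ]≔ inside
⊆∧∣∣≡1+⇒≔ (inside ∷ b)  (inside ∷ d)  b⊆d eq =
  let i , i∉b , d≡ = ⊆∧∣∣≡1+⇒≔ b d (drop-∷-⊆ b⊆d) (suc-injective eq) in suc i , i∉b , cong (inside ∷_) d≡
⊆∧∣∣≡1+⇒≔ (inside ∷ b)  (outside ∷ d) b⊆d eq = in⊈out b⊆d
⊆∧∣∣≡1+⇒≔ (outside ∷ b) (inside ∷ d)  b⊆d eq =
  zero , refl , cong (inside ∷_) (sym (⊆∧∣∣≡⇒≡ b d (drop-∷-⊆ b⊆d) (sym (suc-injective eq))))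
⊆∧∣∣≡1+⇒≔ (outside ∷ b) (outside ∷ d) b⊆d eq =
  let i , i∉b , d≡ = ⊆∧∣∣≡1+⇒≔ b d (drop-∷-⊆ b⊆d) eq in suc i , i∉b , cong (outside ∷_) d≡

AtLevels : ℕ → ℕ → ℕ → ℕ → Set
AtLevels l κ s t = s ≡ l × t ≡ κ

-- A set one larger than `b` is `b` with some point `i` added. It arises from `inside ∷ b` by
-- exchanging the head point for `i`, and stability keeps the result in `f`.
shifted-covers : ∀ l (f : SetFamily (suc m)) → (∀ i → Stable i f) →
  Covers (AtLevels l (suc l)) (f ∘ (inside ∷_)) (f ∘ (outside ∷_))
shifted-covers l f st b d b⊆d (refl , ∣d∣≡) t =
  let i , i∉b , d≡ = ⊆∧∣∣≡1+⇒≔ b d b⊆d ∣d∣≡ in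
  subst (λ d → T (f (outside ∷ d))) (sym d≡) (st i b i∉b t)

-- Binomial coefficients and interpolation

nCk≤[n+1]C[k+1] : ∀ n k → n C k ≤ suc n C suc k
nCk≤[n+1]C[k+1] n k = ≤-trans (m≤m+n _ _) (≤-reflexive (nCk+nC[k+1]≡[n+1]C[k+1] n k))

nCk≤[n+1]Ck : ∀ n k → n C k ≤ suc n C k
nCk≤[n+1]Ck n zero    = ≤-refl
nCk≤[n+1]Ck n (suc k) = ≤-trans (m≤n+m _ _) (≤-reflexive (nCk+nC[k+1]≡[n+1]C[k+1] n k))

C-diagonal-mono : ∀ l n k → n C k ≤ (l + n) C (l + k)
C-diagonal-mono zero    n k = ≤-refl
C-diagonal-mono (suc l) n k = ≤-trans (C-diagonal-mono l n k) (nCk≤[n+1]C[k+1] (l + n) (l + k))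

1≤[k+j]Ck : ∀ k j → 1 ≤ (k + j) C k
1≤[k+j]Ck zero    j = ≤-refl
1≤[k+j]Ck (suc k) j = ≤-trans (1≤[k+j]Ck k j) (nCk≤[n+1]C[k+1] (k + j) k)

2≤[1+k+1+j]C[1+k] : ∀ k j → 2 ≤ (suc k + suc j) C suc k
2≤[1+k+1+j]C[1+k] k j = begin
  1 + 1                                      ≤⟨ +-mono-≤ (1≤[k+j]Ck k (suc j)) (1≤[k+j]Ck (suc k) j) ⟩
  (k + suc j) C k + suc (k + j) C suc k      ≡⟨ cong (λ z → (k + suc j) C k + z C suc k) (+-suc k j) ⟨
  (k + suc j) C k + (k + suc j) C suc k      ≡⟨ nCk+nC[k+1]≡[n+1]C[k+1] (k + suc j) k ⟩
  (suc k + suc j) C suc k                    ∎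
  where open ≤-Reasoning

-- Compares the star sizes of the two halves in `bisection-slope`. The exact ratio of the
-- coefficients is (w + 1) / (k + 1); equality holds at k = 0 and at w = 0.
[k+1+w]C[k+1]≤1+w*[k+1+w]Ck : ∀ k w → (k + suc w) C suc k ≤ suc (w * ((k + suc w) C k))
[k+1+w]C[k+1]≤1+w*[k+1+w]Ck k zero = ≤-reflexive
  (trans (cong (_C suc k) (+-comm k 1)) (nCn≡1 (suc k)))
[k+1+w]C[k+1]≤1+w*[k+1+w]Ck k (suc w) rewrite +-suc k (suc w) = begin
  suc N C suc k              ≡⟨ nCk+nC[k+1]≡[n+1]C[k+1] N k ⟨
  N C k + N C suc k          ≤⟨ +-monoʳ-≤ (N C k) ([k+1+w]C[k+1]≤1+w*[k+1+w]Ck k w) ⟩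
  N C k + suc (w * (N C k))  ≡⟨ +-suc (N C k) _ ⟩
  suc (suc w * (N C k))      ≤⟨ s≤s (*-monoʳ-≤ (suc w) (nCk≤[n+1]Ck N k)) ⟩
  suc (suc w * (suc N C k))  ∎
  where
  open ≤-Reasoning
  N = k + suc w

*-swapˡ : ∀ a b c → a * (b * c) ≡ b * (a * c)
*-swapˡ = solve-∀

-- The first hypothesis says p / (p + q) ≤ p₀ / (p₀ + q₀), and V + E s increases with the position
-- s. Everything is cross-multiplied to stay within the natural numbers.
mediant : ∀ {p q p₀ q₀ V E u} → p * q₀ ≤ p₀ * q → 1 ≤ p₀ + q₀ →
  p₀ * (V + E) + q₀ * V ≤ (p₀ + q₀) * u → p * (V + E) + q * V ≤ (p + q) * u
mediant {p} {q} {p₀} {q₀} {V} {E} {u} pq₀≤p₀q 1≤ h =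
  *-cancelˡ-≤ (p₀ + q₀) {{>-nonZero 1≤}} (begin
    (p₀ + q₀) * (p * (V + E) + q * V)
      ≡⟨ expand p q p₀ q₀ V E ⟩
    (p + q) * ((p₀ + q₀) * V) + (p₀ * p + p * q₀) * E
      ≤⟨ +-monoʳ-≤ ((p + q) * ((p₀ + q₀) * V)) (*-monoˡ-≤ E (+-monoʳ-≤ (p₀ * p) pq₀≤p₀q)) ⟩
    (p + q) * ((p₀ + q₀) * V) + (p₀ * p + p₀ * q) * E
      ≡⟨ contract p q p₀ q₀ V E ⟩
    (p + q) * (p₀ * (V + E) + q₀ * V)
      ≤⟨ *-monoʳ-≤ (p + q) h ⟩
    (p + q) * ((p₀ + q₀) * u)
      ≡⟨ *-swapˡ (p + q) (p₀ + q₀) u ⟩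
    (p₀ + q₀) * ((p + q) * u) ∎)
  where
  open ≤-Reasoning
  expand : ∀ p q p₀ q₀ V E → (p₀ + q₀) * (p * (V + E) + q * V)
    ≡ (p + q) * ((p₀ + q₀) * V) + (p₀ * p + p * q₀) * E
  expand = solve-∀
  contract : ∀ p q p₀ q₀ V E → (p + q) * ((p₀ + q₀) * V) + (p₀ * p + p₀ * q) * E
    ≡ (p + q) * (p₀ * (V + E) + q₀ * V)
  contract = solve-∀

-- Let r = p + q be fixed. Both (p z + q w) / r and (p + 1) z / (r + 1) are linear in p; they agree
-- at p = r, and at p = 0 the second is the smaller because z ≤ (r + 1) w. For r = 0 the claim is z
-- ≤ w ≤ x.
chord-slope : ∀ p q {w z x} → p * z + q * w ≤ (p + q) * x → w ≤ x → z ≤ suc (p + q) * w →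
  suc p * z ≤ suc (p + q) * x
chord-slope p q {w} {z} {x} h w≤x z≤ with p + q in eq
... | zero rewrite m+n≡0⇒m≡0 p eq =
  +-monoˡ-≤ 0 (≤-trans (≤-trans z≤ (≤-reflexive (+-identityʳ w))) w≤x)
... | r@(suc _) = *-cancelˡ-≤ r (begin
  r * (suc p * z)                      ≡⟨ cong (_* (suc p * z)) eq ⟨
  (p + q) * (suc p * z)                ≡⟨ expand p q z ⟩
  suc (p + q) * (p * z) + q * z        ≡⟨ cong (λ r → suc r * (p * z) + q * z) eq ⟩
  suc r * (p * z) + q * z              ≤⟨ +-monoʳ-≤ (suc r * (p * z)) (*-monoʳ-≤ q z≤) ⟩
  suc r * (p * z) + q * (suc r * w)    ≡⟨ contract (suc r) (p * z) q w ⟩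
  suc r * (p * z + q * w)              ≤⟨ *-monoʳ-≤ (suc r) h ⟩
  suc r * (r * x)                      ≡⟨ *-swapˡ (suc r) r x ⟩
  r * (suc r * x)                      ∎)
  where
  open ≤-Reasoning
  expand : ∀ p q z → (p + q) * (suc p * z) ≡ suc (p + q) * (p * z) + q * z
  expand = solve-∀
  contract : ∀ a b q w → a * b + q * (a * w) ≡ a * (b + q * w)
  contract = solve-∀

-- Sizes of upper shadows

-- Here `suc p` is the minimum of `b` and `Y`, and `p`, `q` divide the chord from 1 to `Y`. The last
-- component tells whether the end of the chord was reached or `b` was left unchanged.
truncate : ∀ b Y → 1 ≤ b → 1 ≤ Y →
  ∃[ p ] ∃[ q ] suc (p + q) ≡ Y × suc p ≤ b × (q ≡ 0 ⊎ b ≡ suc p)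
truncate (suc b) (suc y) _ _ with ≤-total b y
... | inj₁ b≤y = b , proj₁ (m≤n⇒∃[o]m+o≡n b≤y) , cong suc (proj₂ (m≤n⇒∃[o]m+o≡n b≤y)) , ≤-refl , inj₂ refl
... | inj₂ y≤b = y , 0 , cong suc (+-identityʳ y) , s≤s y≤b , inj₁ refl

count-positive⇒∃ : ∀ l (f : SetFamily n) → 1 ≤ count l f → ∃[ v ] ∣ v ∣ ≡ l × T (f v)
count-positive⇒∃ {zero}  zero f pos with f [] in eq
... | true  = [] , refl , subst T (sym eq) _
... | false = ⊥-elim (n≮0 pos)
count-positive⇒∃ {suc n} zero    f pos =
  let v , ∣v∣ , fv = count-positive⇒∃ zero (f ∘ (outside ∷_)) pos in outside ∷ v , ∣v∣ , fv
count-positive⇒∃ {suc n} (suc l) f pos with count (suc l) (f ∘ (outside ∷_)) in eq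
... | suc _ =
  let v , ∣v∣ , fv = count-positive⇒∃ (suc l) (f ∘ (outside ∷_)) (≤-trans (s≤s z≤n) (≤-reflexive (sym eq)))
  in outside ∷ v , ∣v∣ , fv
... | zero  =
  let v , ∣v∣ , fv = count-positive⇒∃ l (f ∘ (inside ∷_)) pos in inside ∷ v , cong suc ∣v∣ , fv

count-outside≤ : ∀ l (f : SetFamily (suc n)) → count l (f ∘ (outside ∷_)) ≤ count l f
count-outside≤ zero    f = ≤-refl
count-outside≤ (suc l) f = m≤m+n _ _

-- The supersets of `b` of size `κ` correspond to the `δ`-subsets of the `r` points outside `b`.
count-supersets : ∀ (b : Subset n) κ δ r (f : SetFamily n) → κ ≡ ∣ b ∣ + δ → n ≡ ∣ b ∣ + r →
  (∀ d → b ⊆ d → ∣ d ∣ ≡ κ → T (f d)) → r C δ ≤ count κ f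
count-supersets [] κ zero zero f refl refl h with f [] | h [] ⊆-refl refl
... | true | _ = ≤-refl
count-supersets [] κ (suc δ) zero f _ _ h = z≤n
count-supersets (inside ∷ b) κ δ r f refl eq h = ≤-trans
  (count-supersets b _ δ r (f ∘ (inside ∷_)) refl (suc-injective eq)
    (λ d b⊆d e → h (inside ∷ d) (s⊆s b⊆d) (cong suc e)))
  (m≤n+m _ _)
count-supersets (outside ∷ b) κ δ zero f refl eq h =
  ⊥-elim (<⇒≢ (s≤s (∣p∣≤n b)) (sym (trans eq (+-identityʳ _))))
count-supersets (outside ∷ b) κ zero (suc r) f κ≡ eq h = ≤-trans
  (count-supersets b κ zero r (f ∘ (outside ∷_)) κ≡ (suc-injective (trans eq (+-suc _ r)))
    (λ d b⊆d e → h (outside ∷ d) (s⊆s b⊆d) e))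
  (count-outside≤ κ f)
count-supersets (outside ∷ b) κ (suc δ) (suc r) f κ≡ eq h rewrite trans κ≡ (+-suc ∣ b ∣ δ) = begin
  suc r C suc δ        ≡⟨ nCk+nC[k+1]≡[n+1]C[k+1] r δ ⟨
  r C δ + r C suc δ    ≡⟨ +-comm (r C δ) _ ⟩
  r C suc δ + r C δ    ≤⟨ +-mono-≤
    (count-supersets b _ (suc δ) r (f ∘ (outside ∷_)) (sym (+-suc ∣ b ∣ δ)) n≡
      (λ d b⊆d e → h (outside ∷ d) (s⊆s b⊆d) e))
    (count-supersets b _ δ r (f ∘ (inside ∷_)) refl n≡
      (λ d b⊆d e → h (inside ∷ d) (out⊆ b⊆d) (cong suc e))) ⟩
  _                    ∎
  where
  open ≤-Reasoning
  n≡ = suc-injective (trans eq (+-suc _ r))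

-- The left end of the chord: the supersets of a single member already suffice.
upper-shadow-nonempty-bound : ∀ l δ ε κ → κ ≡ l + δ → n ≡ κ + ε → ∀ {f g : SetFamily n} →
  Covers (AtLevels l κ) f g → 1 ≤ count l f → (δ + ε) C δ ≤ count κ g
upper-shadow-nonempty-bound l δ ε κ κ≡ n≡ {f} {g} cov pos with b , refl , fb ← count-positive⇒∃ l f pos =
  count-supersets b κ δ (δ + ε) g κ≡ (trans n≡ (trans (cong (_+ ε) κ≡) (+-assoc l δ ε)))
    (λ d b⊆d e → cov b d b⊆d (refl , e) fb)

-- p₀ / (p₀ + q₀) and p₁ / (p₁ + q₁) are the positions of the halves of f (without and with the
-- head point) on their chords; the conclusion says that the half without the head point is at
-- least as far along its chord as f is.
bisection-slope : ∀ {p q p₀ q₀ p₁ q₁ w b₀ b₁} →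
  suc (p + q) ≡ suc (p₀ + q₀) + suc (p₁ + q₁) → suc p ≤ b₀ + b₁ →
  b₀ ≡ suc p₀ → q₁ ≡ 0 ⊎ b₁ ≡ suc p₁ →
  p₁ * suc (p₀ + q₀) + q₁ * suc w ≤ (p₁ + q₁) * b₀ → suc w ≤ b₀ →
  suc (p₀ + q₀) ≤ suc (w * suc (p₁ + q₁)) →
  p * q₀ ≤ p₀ * q
bisection-slope {p} {q} {p₀} {q₀} {p₁} {q₁} {w} {b₀} {b₁} Y≡ p<b refl t₁ h (s≤s w≤p₀) (s≤s z≤) = conclude t₁
  where
  open ≤-Reasoning
  expand : ∀ p q z w → p * suc z + q * suc w ≡ (p + q) + (p * z + q * w)
  expand = solve-∀
  -- All sizes are lowered by one, which turns the chord from `suc w` to `suc (p₀ + q₀)` into the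
  -- one from `w` to `p₀ + q₀`.
  slope : suc p₁ * (p₀ + q₀) ≤ suc (p₁ + q₁) * p₀
  slope = chord-slope p₁ q₁
    (+-cancelˡ-≤ (p₁ + q₁) _ _ (begin
      (p₁ + q₁) + (p₁ * (p₀ + q₀) + q₁ * w)  ≡⟨ expand p₁ q₁ (p₀ + q₀) w ⟨
      p₁ * suc (p₀ + q₀) + q₁ * suc w        ≤⟨ h ⟩
      (p₁ + q₁) * suc p₀                     ≡⟨ *-suc (p₁ + q₁) p₀ ⟩
      (p₁ + q₁) + (p₁ + q₁) * p₀             ∎))
    w≤p₀ (≤-trans z≤ (≤-reflexive (*-comm w _)))
  conclude : q₁ ≡ 0 ⊎ b₁ ≡ suc p₁ → p * q₀ ≤ p₀ * q
  -- The half with the head point has reached the size of a star, which forces q₀ = 0.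
  conclude (inj₁ refl) = begin
    p * q₀  ≡⟨ cong (p *_) (n≤0⇒n≡0 (+-cancelˡ-≤ p₀ _ _ (begin
                 p₀ + q₀  ≤⟨ *-cancelˡ-≤ (suc p₁) (subst (λ r → suc p₁ * (p₀ + q₀) ≤ suc r * p₀) (+-identityʳ p₁) slope) ⟩
                 p₀       ≡⟨ +-identityʳ p₀ ⟨
                 p₀ + 0   ∎))) ⟩
    p * 0   ≡⟨ *-zeroʳ p ⟩
    0       ≤⟨ z≤n ⟩
    p₀ * q  ∎
  -- Here p / (p + q) is at most the mediant of p₀ / (p₀ + q₀) and b₁ / (p₁ + q₁ + 1), and by
  -- `slope` the second fraction is not the larger one.
  conclude (inj₂ refl) = +-cancelˡ-≤ (p * p₀) _ _ (begin
    p * p₀ + p * q₀                              ≡⟨ *-distribˡ-+ p p₀ q₀ ⟨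
    p * (p₀ + q₀)                                ≤⟨ *-monoˡ-≤ (p₀ + q₀) (s≤s⁻¹ p<b) ⟩
    (p₀ + suc p₁) * (p₀ + q₀)                    ≡⟨ *-distribʳ-+ (p₀ + q₀) p₀ (suc p₁) ⟩
    p₀ * (p₀ + q₀) + suc p₁ * (p₀ + q₀)          ≤⟨ +-monoʳ-≤ (p₀ * (p₀ + q₀)) slope ⟩
    p₀ * (p₀ + q₀) + suc (p₁ + q₁) * p₀          ≡⟨ collect p₀ (p₀ + q₀) (suc (p₁ + q₁)) ⟩
    p₀ * ((p₀ + q₀) + suc (p₁ + q₁))             ≡⟨ cong (p₀ *_) (suc-injective Y≡) ⟨
    p₀ * (p + q)                                 ≡⟨ distrib p₀ p q ⟩
    p * p₀ + p₀ * q                              ∎)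
    where
    collect : ∀ a b c → a * b + c * a ≡ a * (b + c)
    collect = solve-∀
    distrib : ∀ a b c → a * (b + c) ≡ b * a + a * c
    distrib = solve-∀

module _ where
  open ≤-Reasoning

  -- Over the ground set of size m + 1 let f consist of sets of size l + 1 and g of sets of size
  -- κ + 1. As |f| grows from 1 to (m C l), the size of a star, the least possible |g| is at least
  -- the linear interpolation between the values ((δ + ε) C δ) and (m C κ) at the two ends. Here
  -- p / (p + q) is the position (|f| - 1) / ((m C l) - 1), with |f| truncated at a star.
  chord-bound : ∀ m l δ ε κ → κ ≡ l + δ → m ≡ κ + ε → ∀ (f g : SetFamily (suc m)) →
    Covers (AtLevels (suc l) (suc κ)) f g → ∀ p q → suc (p + q) ≡ m C l → suc p ≤ count (suc l) f →
    p * (m C κ) + q * ((δ + ε) C δ) ≤ (p + q) * count (suc κ) g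
  chord-bound m zero δ ε κ _ _ f g cov p q Y≡ p<b
    with refl ← m+n≡0⇒m≡0 p (suc-injective Y≡) | refl ← m+n≡0⇒n≡0 p (suc-injective Y≡) = z≤n
  -- Equal levels: `g` contains the sets counted in `f`, and the chord is the identity.
  chord-bound m l@(suc _) zero ε κ κ≡ _ f g cov p q Y≡ p<b
    with refl ← trans κ≡ (+-identityʳ l) = begin
    p * (m C l) + q * 1              ≡⟨ cong (λ z → p * z + q * 1) Y≡ ⟨
    p * suc (p + q) + q * 1          ≡⟨ eq p q ⟩
    (p + q) * suc p                  ≤⟨ *-monoʳ-≤ (p + q) (≤-trans p<b (count-mono (suc l)
                                          (λ v e t → cov v v ⊆-refl (e , e) t))) ⟩
    (p + q) * count (suc l) g        ∎
    where
    eq : ∀ p q → p * suc (p + q) + q * 1 ≡ (p + q) * suc p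
    eq = solve-∀
  -- Top level: only the whole ground set has this size, and both ends of the chord are 1.
  chord-bound m l@(suc _) δ@(suc _) zero κ κ≡ m≡ f g cov p q Y≡ p<b
    with refl ← trans m≡ (+-identityʳ κ) = begin
    p * (m C m) + q * ((δ + 0) C δ)  ≡⟨ cong₂ (λ x y → p * x + q * y) (nCn≡1 m) VC ⟩
    p * 1 + q * 1                    ≡⟨ *-distribʳ-+ 1 p q ⟨
    (p + q) * 1                      ≤⟨ *-monoʳ-≤ (p + q) (≤-trans (≤-reflexive (sym VC))
                                          (upper-shadow-nonempty-bound (suc l) δ 0 (suc m) (cong suc κ≡)
                                             (sym (+-identityʳ (suc m))) cov (≤-trans (s≤s z≤n) p<b))) ⟩
    (p + q) * count (suc m) g        ∎
    where
    VC : (δ + 0) C δ ≡ 1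
    VC = trans (cong (_C δ) (+-identityʳ δ)) (nCn≡1 δ)
  chord-bound (suc m) l@(suc l′) δ@(suc δ′) ε@(suc ε′) (suc κ) κ≡ m≡ f₋ g₋ cov₋ p q Y≡ p<b₋ = goal
    where
    κ≡′ : κ ≡ l + δ′
    κ≡′ = suc-injective (trans κ≡ (+-suc l δ′))
    m≡κ+ε : m ≡ κ + ε
    m≡κ+ε = suc-injective m≡
    -- A set counted by `b₁` misses `suc w` of the `suc m` remaining points, so its upper shadow one
    -- level up has `suc w` members.
    w : ℕ
    w = δ′ + ε
    m≡l′+1+w : m ≡ l′ + suc w
    m≡l′+1+w = trans m≡κ+ε (trans (cong (_+ ε) κ≡′)
      (trans (cong suc (+-assoc l′ δ′ ε)) (sym (+-suc l′ w))))

    f g f₀ f₁ g₀ g₁ : SetFamily _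
    f  = shiftAll (allFin (suc m)) f₋
    g  = shiftAll (allFin (suc m)) g₋
    f₀ = f ∘ (outside ∷_)
    f₁ = f ∘ (inside ∷_)
    g₀ = g ∘ (outside ∷_)
    g₁ = g ∘ (inside ∷_)
    cov : Covers (AtLevels (suc l) (suc (suc κ))) f g
    cov = shiftAll-Covers {P = AtLevels (suc l) (suc (suc κ))} (allFin (suc m)) cov₋
    b₀ b₁ : ℕ
    b₀ = count (suc l) f₀
    b₁ = count l f₁
    p<b : suc p ≤ b₀ + b₁
    p<b = ≤-trans p<b₋ (≤-reflexive (sym (count-shiftAll (suc l) (allFin (suc m)) f₋)))
    cov₁₀ : Covers (AtLevels l (suc l)) f₁ f₀
    cov₁₀ = shifted-covers l f (λ i → shiftAll-stable (allFin (suc m)) f₋ (∈-allFin i))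

    1+w≤b₀ : 1 ≤ b₁ → suc w ≤ b₀
    1+w≤b₀ 1≤b₁ = ≤-trans (≤-reflexive (sym (nC1≡n (suc w))))
      (upper-shadow-nonempty-bound l 1 w (suc l) (+-comm 1 l)
        (cong suc (trans m≡l′+1+w (+-suc l′ w))) cov₁₀ 1≤b₁)
    1≤b₀ : 1 ≤ b₀
    1≤b₀ with b₁ in eq
    ... | suc _ = ≤-trans (s≤s z≤n) (1+w≤b₀ (≤-trans (s≤s z≤n) (≤-reflexive (sym eq))))
    ... | zero  = ≤-trans (s≤s z≤n) (≤-trans p<b (≤-reflexive (trans (cong (b₀ +_) eq) (+-identityʳ b₀))))

    -- This makes p₀ + q₀ positive, as the cancellation in `mediant` requires.
    2≤mCl : 2 ≤ m C l
    2≤mCl = subst (λ m → 2 ≤ m C l)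
      (sym (trans m≡l′+1+w (trans (+-suc l′ w) (cong (suc l′ +_) (+-suc δ′ ε′)))))
      (2≤[1+k+1+j]C[1+k] l′ (δ′ + ε′))

    goal : p * (suc m C suc κ) + q * ((δ + ε) C δ) ≤ (p + q) * count (suc (suc κ)) g₋
    goal with p₀ , q₀ , Y₀≡ , p₀<b₀ , t₀ ← truncate b₀ (m C l) 1≤b₀ (≤-trans (s≤s z≤n) 2≤mCl) = begin
      p * (suc m C suc κ) + q * V         ≡⟨ cong (λ W → p * W + q * V) W≡V+E ⟩
      p * (V + E) + q * V                 ≤⟨ mediant {p} {q} {p₀} {q₀} {V} {E} (slope t₀)
                                               (s≤s⁻¹ (≤-trans 2≤mCl (≤-reflexive (sym Y₀≡)))) IH ⟩
      (p + q) * count (suc (suc κ)) g     ≡⟨ cong ((p + q) *_)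
                                               (count-shiftAll (suc (suc κ)) (allFin (suc m)) g₋) ⟩
      (p + q) * count (suc (suc κ)) g₋    ∎
      where
      V E : ℕ
      V = (δ + ε) C δ
      V≤W : V ≤ suc m C suc κ
      V≤W = subst₂ (λ m κ → V ≤ m C κ)
        (sym (trans m≡ (trans (cong (_+ ε) κ≡) (+-assoc l δ ε)))) (sym κ≡) (C-diagonal-mono l (δ + ε) δ)
      E = proj₁ (m≤n⇒∃[o]m+o≡n V≤W)
      W≡V+E : suc m C suc κ ≡ V + E
      W≡V+E = sym (proj₂ (m≤n⇒∃[o]m+o≡n V≤W))

      IH₀ : p₀ * (m C suc κ) + q₀ * ((δ + ε′) C δ) ≤ (p₀ + q₀) * count (suc (suc κ)) g₀
      IH₀ = chord-bound m l δ ε′ (suc κ) κ≡ (trans m≡κ+ε (+-suc κ ε′)) f₀ g₀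
        (λ b d b⊆d → cov (outside ∷ b) (outside ∷ d) (s⊆s b⊆d)) p₀ q₀ Y₀≡ p₀<b₀
      -- Supersets of a member of `f₀` may also use the head point, so `g₁` contains the upper
      -- shadow of `f₀` one level lower.
      IH₁ : p₀ * (m C κ) + q₀ * ((δ′ + ε) C δ′) ≤ (p₀ + q₀) * count (suc κ) g₁
      IH₁ = chord-bound m l δ′ ε κ κ≡′ m≡κ+ε f₀ g₁
        (λ b d b⊆d (e , e′) → cov (outside ∷ b) (inside ∷ d) (out⊆ b⊆d) (e , cong suc e′)) p₀ q₀ Y₀≡ p₀<b₀
      -- By Pascal's rule the ends of the two smaller chords add up to the ends of the large one.
      IH : p₀ * (V + E) + q₀ * V ≤ (p₀ + q₀) * count (suc (suc κ)) g
      IH = begin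
        p₀ * (V + E) + q₀ * V
          ≡⟨ cong₂ (λ x y → p₀ * x + q₀ * y) W≡V+E (nCk+nC[k+1]≡[n+1]C[k+1] (δ′ + ε) δ′) ⟨
        p₀ * (suc m C suc κ) + q₀ * ((δ′ + ε) C δ′ + (δ′ + ε) C δ)
          ≡⟨ cong₂ (λ x y → p₀ * x + q₀ * ((δ′ + ε) C δ′ + y C δ))
               (sym (nCk+nC[k+1]≡[n+1]C[k+1] m κ)) (+-suc δ′ ε′) ⟩
        p₀ * (m C κ + m C suc κ) + q₀ * ((δ′ + ε) C δ′ + (δ + ε′) C δ)
          ≡⟨ regroup p₀ (m C κ) (m C suc κ) q₀ ((δ′ + ε) C δ′) ((δ + ε′) C δ) ⟩
        (p₀ * (m C suc κ) + q₀ * ((δ + ε′) C δ)) + (p₀ * (m C κ) + q₀ * ((δ′ + ε) C δ′))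
          ≤⟨ +-mono-≤ IH₀ IH₁ ⟩
        (p₀ + q₀) * count (suc (suc κ)) g₀ + (p₀ + q₀) * count (suc κ) g₁
          ≡⟨ *-distribˡ-+ (p₀ + q₀) _ _ ⟨
        (p₀ + q₀) * count (suc (suc κ)) g ∎
        where
        regroup : ∀ p a b q c d → p * (a + b) + q * (c + d) ≡ (p * b + q * d) + (p * a + q * c)
        regroup = solve-∀

      Y≡Y₀+Y₁ : suc (p + q) ≡ suc (p₀ + q₀) + m C l′
      Y≡Y₀+Y₁ = trans Y≡ (trans (sym (nCk+nC[k+1]≡[n+1]C[k+1] m l′))
        (trans (+-comm (m C l′) (m C l)) (cong (_+ m C l′) (sym Y₀≡))))
      1≤mCl′ : 1 ≤ m C l′
      1≤mCl′ = subst (λ m → 1 ≤ m C l′) (sym m≡l′+1+w) (1≤[k+j]Ck l′ (suc w))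

      slope : q₀ ≡ 0 ⊎ b₀ ≡ suc p₀ → p * q₀ ≤ p₀ * q
      slope t₀ with t₀ | b₁ in b₁≡
      ... | inj₁ refl | _ = ≤-trans (≤-reflexive (*-zeroʳ p)) z≤n
      -- All counted members of `f` avoid the head point, so `f` has come no farther than `f₀`, on a
      -- chord that is no shorter.
      ... | inj₂ b₀≡ | zero = *-mono-≤ p≤p₀ (+-cancelˡ-≤ p₀ _ _ (begin
        p₀ + q₀              ≤⟨ m≤m+n _ _ ⟩
        p₀ + q₀ + m C l′     ≡⟨ suc-injective Y≡Y₀+Y₁ ⟨
        p + q                ≤⟨ +-monoˡ-≤ q p≤p₀ ⟩
        p₀ + q               ∎))
        where
        p≤p₀ : p ≤ p₀
        p≤p₀ = s≤s⁻¹ (≤-trans p<b (≤-reflexive (trans (cong₂ _+_ b₀≡ b₁≡) (+-identityʳ (suc p₀)))))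
      ... | inj₂ b₀≡ | suc b₁-1
        with p₁ , q₁ , Y₁≡ , p₁<b₁ , t₁ ←
          truncate b₁ (m C l′) (≤-trans (s≤s z≤n) (≤-reflexive (sym b₁≡))) 1≤mCl′ =
        bisection-slope {p} {q} {p₀} {q₀} {p₁} {q₁} {w} {b₀} {b₁}
          (trans Y≡Y₀+Y₁ (cong (suc (p₀ + q₀) +_) (sym Y₁≡))) p<b b₀≡ t₁
          -- The induction hypothesis for `f₁` and `f₀`, one level apart, bounds `b₀` below by the
          -- chord from `suc w` to `m C l`.
          (subst₂ (λ y ν → p₁ * y + q₁ * ν ≤ (p₁ + q₁) * b₀) (sym Y₀≡) (nC1≡n (suc w))
            (chord-bound m l′ 1 w l (+-comm 1 l′) (trans m≡l′+1+w (+-suc l′ w)) f₁ f₀ cov₁₀ p₁ q₁ Y₁≡ p₁<b₁))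
          (1+w≤b₀ (≤-trans (s≤s z≤n) (≤-reflexive (sym b₁≡))))
          (subst₂ (λ y y′ → y ≤ suc (w * y′)) (sym Y₀≡) (sym Y₁≡)
            (subst (λ m → m C l ≤ suc (w * (m C l′))) (sym m≡l′+1+w)
              ([k+1+w]C[k+1]≤1+w*[k+1+w]Ck l′ w)))
  chord-bound (suc m) (suc l) (suc δ) (suc ε) zero () m≡
  chord-bound zero (suc l) (suc δ) (suc ε) (suc κ) κ≡ ()
  chord-bound zero (suc l) (suc δ) (suc ε) zero () m≡

-- Cross-intersecting families

count-const-false : ∀ n l → count {n} l (const false) ≡ 0
count-const-false zero    zero    = refl
count-const-false zero    (suc l) = refl
count-const-false (suc n) zero    = count-const-false n zero
count-const-false (suc n) (suc l) = cong₂ _+_ (count-const-false n (suc l)) (count-const-false n l)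

count-not : ∀ l (f : SetFamily n) → count l f + count l (not ∘ f) ≡ n C l
count-not {n} l f = begin
  count l f + count l (not ∘ f)
    ≡⟨ count-∨-∧ l f (not ∘ f) ⟨
  count l (λ v → f v ∨ not (f v)) + count l (λ v → not (f v) ∧ f v)
    ≡⟨ cong₂ _+_ (count-cong l (∨-inverseʳ ∘ f)) (count-cong l (∧-inverseˡ ∘ f)) ⟩
  count {n} l (const true) + count {n} l (const false)
    ≡⟨ cong₂ _+_ (count-const-true n l) (count-const-false n l) ⟩
  n C l + 0
    ≡⟨ +-identityʳ (n C l) ⟩
  n C l ∎
  where open ≡-Reasoning

count-overflow : ∀ l (f : SetFamily n) → n < l → count l f ≡ 0
count-overflow {n} l f n<l = n≤0⇒n≡0 (begin
  count l f                       ≤⟨ m≤m+n _ _ ⟩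
  count l f + count l (not ∘ f)   ≡⟨ count-not l f ⟩
  n C l                           ≡⟨ k>n⇒nCk≡0 n<l ⟩
  0                               ∎)
  where open ≤-Reasoning

count-∁ : ∀ κ k (f : SetFamily n) → κ + k ≡ n → count κ (f ∘ ∁) ≡ count k f
count-∁ {zero}  zero    zero    f eq = refl
count-∁ {suc n} zero    (suc k) f eq = trans
  (count-∁ zero k (f ∘ (inside ∷_)) (suc-injective eq))
  (cong (_+ count k (f ∘ (inside ∷_))) (sym (count-overflow (suc k) (f ∘ (outside ∷_)) (≤-reflexive (sym eq)))))
count-∁ {suc n} (suc κ) zero    f eq = trans
  (cong (_+ count κ (f ∘ (outside ∷_) ∘ ∁))
    (count-overflow (suc κ) (f ∘ (inside ∷_) ∘ ∁) (≤-reflexive (trans (sym eq) (+-identityʳ (suc κ))))))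
  (count-∁ κ zero (f ∘ (outside ∷_)) (suc-injective eq))
count-∁ {suc n} (suc κ) (suc k) f eq = trans
  (cong₂ _+_ (count-∁ (suc κ) k (f ∘ (inside ∷_)) (trans (sym (+-suc κ k)) (suc-injective eq)))
             (count-∁ κ (suc k) (f ∘ (outside ∷_)) (suc-injective eq)))
  (+-comm (count k (f ∘ (inside ∷_))) _)

CrossIntersect : ℕ → SetFamily n → SetFamily n → Set
CrossIntersect k f g = ∀ a b → ∣ a ∣ ≡ k → ∣ b ∣ ≡ k → T (f a) → T (g b) → Nonempty (a ∩ b)

-- a and b are disjoint exactly if b is contained in the complement of a, so the complements of
-- the k-sets missing from g contain the upper shadow of f.
cross-intersect⇒covers : ∀ k κ → k + κ ≡ n → ∀ {f g : SetFamily n} → CrossIntersect k f g →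
  Covers (AtLevels k κ) f (not ∘ g ∘ ∁)
cross-intersect⇒covers k κ eq {f} {g} cross b d b⊆d (refl , ∣d∣≡) fb with g (∁ d) in eq′
... | false = _
... | true  with x , x∈b∩∁d ← cross b (∁ d) refl
                   (trans (∣∁p∣≡n∸∣p∣ d) (trans (cong₂ _∸_ (sym eq) ∣d∣≡) (m+n∸n≡m ∣ b ∣ κ)))
                   fb (subst T (sym eq′) _)
            with x∈b , x∈∁d ← x∈p∩q⁻ b (∁ d) x∈b∩∁d = x∈∁p⇒x∉p x∈∁d (b⊆d x∈b)

C-symmetric : ∀ j k → (j + k) C j ≡ (j + k) C k
C-symmetric j k = trans (nCk≡nC[n∸k] (m≤m+n j k)) (cong ((j + k) C_) (m+n∸m≡n j k))

-- With a = |𝒜ᵢ|, D = X - (y + 1) for X = (n C k) ∸ (n ∸ k) C k, and x = X - a, the last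
-- hypothesis bounds S by a linear function of x, so the bound on a + S is largest at x = 0 or x = D.
two-point-bound : ∀ {a x D y} c {S} → a + x ≡ suc y + D → x ≤ D → 1 ≤ D → S * D ≤ c * (D + y * x) →
  a + S ≤ (suc y + D + c) ⊔ (suc c * suc y)
two-point-bound {a} {x} {D} {y} c {S} a+x≡ x≤D 1≤D h with ≤-total (c * y) D
... | inj₁ cy≤D = ≤-trans (begin
  a + S                ≤⟨ +-monoʳ-≤ a (*-cancelʳ-≤ S (x + c) D {{>-nonZero 1≤D}} (begin
      S * D                  ≤⟨ h ⟩
      c * (D + y * x)        ≡⟨ expand c D y x ⟩
      c * y * x + c * D      ≤⟨ +-monoˡ-≤ (c * D) (*-monoˡ-≤ x cy≤D) ⟩
      D * x + c * D          ≡⟨ collect D x c ⟩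
      (x + c) * D            ∎)) ⟩
  a + (x + c)          ≡⟨ +-assoc a x c ⟨
  a + x + c            ≡⟨ cong (_+ c) a+x≡ ⟩
  suc y + D + c        ∎) (m≤m⊔n (suc y + D + c) (suc c * suc y))
  where
  open ≤-Reasoning
  expand : ∀ c D y x → c * (D + y * x) ≡ c * y * x + c * D
  expand = solve-∀
  collect : ∀ D x c → D * x + c * D ≡ (x + c) * D
  collect = solve-∀
... | inj₂ D≤cy with e , D+e≡cy ← m≤n⇒∃[o]m+o≡n D≤cy = ≤-trans (begin
  a + S                      ≤⟨ +-monoʳ-≤ a (*-cancelʳ-≤ S (x + (c + e)) D {{>-nonZero 1≤D}} (begin
      S * D                        ≤⟨ h ⟩
      c * (D + y * x)              ≡⟨ expand c D y x ⟩
      c * y * x + c * D            ≡⟨ cong (λ z → z * x + c * D) D+e≡cy ⟨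
      (D + e) * x + c * D          ≡⟨ distrib D e x c ⟩
      D * x + c * D + e * x        ≤⟨ +-monoʳ-≤ (D * x + c * D) (*-monoʳ-≤ e x≤D) ⟩
      D * x + c * D + e * D        ≡⟨ collect D x c e ⟩
      (x + (c + e)) * D            ∎)) ⟩
  a + (x + (c + e))          ≡⟨ +-assoc a x (c + e) ⟨
  a + x + (c + e)            ≡⟨ cong (_+ (c + e)) a+x≡ ⟩
  suc y + D + (c + e)        ≡⟨ regroup y D c e ⟩
  suc y + (c + (D + e))      ≡⟨ cong (λ z → suc y + (c + z)) D+e≡cy ⟩
  suc y + (c + c * y)        ≡⟨ cong (suc y +_) (*-suc c y) ⟨
  suc c * suc y              ∎) (m≤n⊔m (suc y + D + c) (suc c * suc y))
  where
  open ≤-Reasoning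
  expand : ∀ c D y x → c * (D + y * x) ≡ c * y * x + c * D
  expand = solve-∀
  distrib : ∀ D e x c → (D + e) * x + c * D ≡ D * x + c * D + e * x
  distrib = solve-∀
  collect : ∀ D x c e → D * x + c * D + e * D ≡ (x + (c + e)) * D
  collect = solve-∀
  regroup : ∀ y D c e → suc y + D + (c + e) ≡ suc y + (c + (D + e))
  regroup = solve-∀

sum-bounded : ∀ c (b : Fin c → ℕ) {D M} → (∀ j → b j * D ≤ M) → sum b * D ≤ c * M
sum-bounded zero    b h = z≤n
sum-bounded (suc c) b {D} h = ≤-trans (≤-reflexive (*-distribʳ-+ D (b zero) _))
  (+-mono-≤ (h zero) (sum-bounded c (b ∘ suc) (h ∘ suc)))

sum-≤ : ∀ c (b : Fin c → ℕ) {M} → (∀ j → b j ≤ M) → sum b ≤ c * M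
sum-≤ zero    b h = z≤n
sum-≤ (suc c) b h = +-mono-≤ (h zero) (sum-≤ c (b ∘ suc) (h ∘ suc))

sum-const : ∀ c x → sum {c} (const x) ≡ c * x
sum-const zero    x = refl
sum-const (suc c) x = cong (x +_) (sum-const c x)

-- A positive `p` cancels and leaves D ≤ x. If p = 0, then m C l = 1 with l < m forces l = 0, where
-- the two ends of the chord coincide and D = 0.
full-star-absurd : ∀ l d m → m ≡ l + d + suc l → ∀ {V D p x} → (d + suc l) C d ≡ V → m C (l + d) ≡ V + D →
  suc p ≡ m C l → p * D ≤ p * x → ¬ x < D
full-star-absurd l       d m m≡   {p = suc p} V≡   W≡ Y≡ h x<D = <⇒≱ x<D (*-cancelˡ-≤ (suc p) h)
full-star-absurd zero    d m refl {V} {p = zero} refl W≡ Y≡ h x<D =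
  n≮0 (subst (_ <_) (+-cancelˡ-≡ V _ 0 (trans (sym W≡) (sym (+-identityʳ V)))) x<D)
full-star-absurd (suc l) d m m≡   {p = zero} V≡   W≡ Y≡ h x<D = <⇒≢
  (subst (λ m → 2 ≤ m C suc l)
    (sym (trans m≡ (trans (+-assoc (suc l) d _) (cong (suc l +_) (+-suc d (suc l))))))
    (2≤[1+k+1+j]C[1+k] l (d + suc l))) Y≡

-- The `V + x` sets missing from `g` are at least as many as the chord demands for `f`, which gives
-- (|f| - 1) D ≤ y x. The hypothesis `x < D` says that `g` is larger than a star; it excludes the
-- case that the chord for `f` ended at a star.
pair-bound : ∀ l d m → m ≡ l + d + suc l → ∀ {V D y x} → (d + suc l) C d ≡ V → m C (l + d) ≡ V + D →
  suc y ≡ m C l → x < D → ∀ (f g : SetFamily (suc m)) → CrossIntersect (suc l) f g → 1 ≤ count (suc l) f →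
  count (suc (l + d)) (not ∘ g ∘ ∁) ≡ V + x → count (suc l) f * D ≤ D + y * x
pair-bound l d m m≡ {V} {D} {y} {x} V≡ W≡ Y≡ x<D f g cross 1≤b u≡
  with p , q , Y≡′ , p<b , t ← truncate (count (suc l) f) (suc y) 1≤b (s≤s z≤n)
  with refl ← Y≡′ = conclude t
  where
  open ≤-Reasoning
  cov : Covers (AtLevels (suc l) (suc (l + d))) f (not ∘ g ∘ ∁)
  cov = cross-intersect⇒covers (suc l) (suc (l + d))
    (cong suc (trans (+-comm l (suc (l + d))) (trans (sym (+-suc (l + d) l)) (sym m≡)))) cross
  expand : ∀ p q V D → p * (V + D) + q * V ≡ (p + q) * V + p * D
  expand = solve-∀
  chord : p * D ≤ (p + q) * x
  chord = +-cancelˡ-≤ ((p + q) * V) _ _ (begin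
    (p + q) * V + p * D                            ≡⟨ expand p q V D ⟨
    p * (V + D) + q * V                            ≡⟨ cong₂ (λ W V → p * W + q * V) W≡ V≡ ⟨
    p * (m C (l + d)) + q * ((d + suc l) C d)      ≤⟨ chord-bound m l d (suc l) (l + d) refl m≡ f _ cov p q Y≡ p<b ⟩
    (p + q) * count (suc (l + d)) (not ∘ g ∘ ∁)    ≡⟨ cong ((p + q) *_) u≡ ⟩
    (p + q) * (V + x)                              ≡⟨ *-distribˡ-+ (p + q) V x ⟩
    (p + q) * V + (p + q) * x                      ∎)
  conclude : q ≡ 0 ⊎ count (suc l) f ≡ suc p → count (suc l) f * D ≤ D + (p + q) * x
  conclude (inj₂ b≡) = ≤-trans (≤-reflexive (cong (_* D) b≡)) (+-monoʳ-≤ D chord)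
  conclude (inj₁ refl) = ⊥-elim (full-star-absurd l d m m≡ V≡ W≡
    (trans (cong suc (sym (+-identityʳ p))) Y≡)
    (≤-trans chord (≤-reflexive (cong (_* x) (+-identityʳ p)))) x<D)

C-symmetric′ : ∀ l d {m} → m ≡ l + d + suc l → m C (l + d) ≡ m C suc l
C-symmetric′ l d refl = C-symmetric (l + d) (suc l)

-- With n = m + 1 and k = l + 1, symmetry turns `V` into C(n-k,k) and `V + D` into C(n-1,k), so
-- C(n,k) - C(n-k,k) is the star size plus `D`.
bound≡ : ∀ l d m c → m ≡ l + d + suc l → ∀ {V D} → (d + suc l) C d ≡ V → m C (l + d) ≡ V + D →
  bound (suc m) (suc l) (suc c) ≡ (m C l + D + c) ⊔ (suc c * (m C l))
bound≡ l d m c m≡ {V} {D} V≡ W≡ = cong (λ X → (X + c) ⊔ (suc c * (m C l))) (begin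
  suc m C suc l ∸ (m ∸ l) C suc l    ≡⟨ cong₂ _∸_ X≡ V′≡ ⟩
  m C l + D + V ∸ V                  ≡⟨ m+n∸n≡m (m C l + D) V ⟩
  m C l + D                          ∎)
  where
  open ≡-Reasoning
  X≡ : suc m C suc l ≡ m C l + D + V
  X≡ = begin
    suc m C suc l         ≡⟨ nCk+nC[k+1]≡[n+1]C[k+1] m l ⟨
    m C l + m C suc l     ≡⟨ cong (m C l +_) (C-symmetric′ l d m≡) ⟨
    m C l + m C (l + d)   ≡⟨ cong (m C l +_) (trans W≡ (+-comm V D)) ⟩
    m C l + (D + V)       ≡⟨ +-assoc (m C l) D V ⟨
    m C l + D + V         ∎
  V′≡ : (m ∸ l) C suc l ≡ V
  V′≡ = begin
    (m ∸ l) C suc l                   ≡⟨ cong (λ m → (m ∸ l) C suc l) (trans m≡ (+-assoc l d (suc l))) ⟩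
    (l + (d + suc l) ∸ l) C suc l     ≡⟨ cong (_C suc l) (m+n∸m≡n l (d + suc l)) ⟩
    (d + suc l) C suc l               ≡⟨ C-symmetric d (suc l) ⟨
    (d + suc l) C d                   ≡⟨ V≡ ⟩
    V                                 ∎

dominant-bound : ∀ l d m c → m ≡ l + d + suc l → (f : Fin (2 + c) → SetFamily (suc m)) →
  (∀ i → 1 ≤ count (suc l) (f i)) → (∀ {i j} → i ≢ j → CrossIntersect (suc l) (f i) (f j)) →
  ∀ i → m C l < count (suc l) (f i) → sum (count (suc l) ∘ f) ≤ bound (suc m) (suc l) (2 + c)
dominant-bound l d m c m≡ f pos cross i Y<a = begin
  sum (count (suc l) ∘ f)
    ≡⟨ sum-remove {i = i} (count (suc l) ∘ f) ⟩
  a + sum (count (suc l) ∘ f ∘ punchIn i)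
    ≤⟨ two-point-bound (suc c) (trans a+x≡ (cong (_+ D) (sym Y≡))) (<⇒≤ x<D) (≤-trans (s≤s z≤n) x<D)
         (sum-bounded (suc c) (count (suc l) ∘ f ∘ punchIn i) others) ⟩
  (suc y + D + suc c) ⊔ (suc (suc c) * suc y)
    ≡⟨ cong (λ Y → (Y + D + suc c) ⊔ (suc (suc c) * Y)) Y≡ ⟩
  (m C l + D + suc c) ⊔ (suc (suc c) * (m C l))
    ≡⟨ bound≡ l d m (suc c) m≡ refl W≡ ⟨
  bound (suc m) (suc l) (2 + c) ∎
  where
  open ≤-Reasoning
  a u V : ℕ
  a = count (suc l) (f i)
  u = count (suc (l + d)) (not ∘ f i ∘ ∁)
  V = (d + suc l) C d
  m≡′ : suc l + suc (l + d) ≡ suc m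
  m≡′ = cong suc (trans (+-comm l (suc (l + d))) (trans (sym (+-suc (l + d) l)) (sym m≡)))
  a+u≡ : a + u ≡ suc m C suc l
  a+u≡ = trans (cong (a +_) (count-∁ (suc (l + d)) (suc l) (not ∘ f i) (trans (+-comm (suc (l + d)) (suc l)) m≡′)))
    (count-not (suc l) (f i))
  V≤u : V ≤ u
  -- The index `punchIn i zero` is a second index; one member of its family already excludes `V`
  -- sets from family `i`.
  V≤u = upper-shadow-nonempty-bound (suc l) d (suc l) (suc (l + d)) refl (cong suc m≡)
    (cross-intersect⇒covers (suc l) (suc (l + d)) m≡′ (cross (punchInᵢ≢i i zero))) (pos _)
  V≤W : V ≤ m C (l + d)
  V≤W = subst (λ m → V ≤ m C (l + d)) (sym (trans m≡ (+-assoc l d (suc l)))) (C-diagonal-mono l (d + suc l) d)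
  D x y : ℕ
  D = proj₁ (m≤n⇒∃[o]m+o≡n V≤W)
  W≡ : m C (l + d) ≡ V + D
  W≡ = sym (proj₂ (m≤n⇒∃[o]m+o≡n V≤W))
  x = proj₁ (m≤n⇒∃[o]m+o≡n V≤u)
  u≡ : u ≡ V + x
  u≡ = sym (proj₂ (m≤n⇒∃[o]m+o≡n V≤u))
  1≤Y : 1 ≤ m C l
  1≤Y = subst (λ m → 1 ≤ m C l) (sym (trans m≡ (+-assoc l d (suc l)))) (1≤[k+j]Ck l (d + suc l))
  y = proj₁ (m≤n⇒∃[o]m+o≡n 1≤Y)
  Y≡ : suc y ≡ m C l
  Y≡ = proj₂ (m≤n⇒∃[o]m+o≡n 1≤Y)
  a+x≡ : a + x ≡ m C l + D
  a+x≡ = +-cancelˡ-≡ V _ _ (begin-equality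
    V + (a + x)            ≡⟨ swap V a x ⟩
    a + (V + x)            ≡⟨ cong (a +_) u≡ ⟨
    a + u                  ≡⟨ a+u≡ ⟩
    suc m C suc l          ≡⟨ nCk+nC[k+1]≡[n+1]C[k+1] m l ⟨
    m C l + m C suc l      ≡⟨ cong (m C l +_) (C-symmetric′ l d m≡) ⟨
    m C l + m C (l + d)    ≡⟨ cong (m C l +_) W≡ ⟩
    m C l + (V + D)        ≡⟨ swap V (m C l) D ⟨
    V + (m C l + D)        ∎)
    where
    swap : ∀ a b c → a + (b + c) ≡ b + (a + c)
    swap = solve-∀
  x<D : x < D
  x<D = +-cancelˡ-< (m C l) x D (<-≤-trans (+-monoˡ-< x Y<a) (≤-reflexive a+x≡))
  others : ∀ j → count (suc l) (f (punchIn i j)) * D ≤ D + y * x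
  others j = pair-bound l d m m≡ refl W≡ Y≡ x<D (f (punchIn i j)) (f i) (cross (punchInᵢ≢i i j)) (pos _) u≡

cross-intersecting-bound : ∀ l d m c → m ≡ l + d + suc l → (f : Fin (2 + c) → SetFamily (suc m)) →
  (∀ i → 1 ≤ count (suc l) (f i)) → (∀ {i j} → i ≢ j → CrossIntersect (suc l) (f i) (f j)) →
  sum (count (suc l) ∘ f) ≤ bound (suc m) (suc l) (2 + c)
cross-intersecting-bound l d m c m≡ f pos cross with any? (λ i → m C l <? count (suc l) (f i))
... | yes (i , Y<a) = dominant-bound l d m c m≡ f pos cross i Y<a
... | no  ¬dominant = ≤-trans
  (sum-≤ (2 + c) (count (suc l) ∘ f) (λ i → ≮⇒≥ (λ Y<a → ¬dominant (i , Y<a))))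
  (m≤n⊔m (suc m C suc l ∸ (m ∸ l) C suc l + suc c) _)

-- Lists of sets and the extremal families

listing : ℕ → SetFamily n → List (Subset n)
listing {zero}  zero    f = if f [] then [] ∷ [] else []
listing {zero}  (suc l) f = []
listing {suc n} zero    f = map (outside ∷_) (listing zero (f ∘ (outside ∷_)))
listing {suc n} (suc l) f =
  map (outside ∷_) (listing (suc l) (f ∘ (outside ∷_))) ++ map (inside ∷_) (listing l (f ∘ (inside ∷_)))

length-listing : ∀ l (f : SetFamily n) → length (listing l f) ≡ count l f
length-listing {zero}  zero    f with f []
... | true  = refl
... | false = refl
length-listing {zero}  (suc l) f = refl
length-listing {suc n} zero    f = trans
  (length-map (outside ∷_) (listing zero (f ∘ (outside ∷_)))) (length-listing zero (f ∘ (outside ∷_)))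
length-listing {suc n} (suc l) f = trans (length-++ (map (outside ∷_) (listing (suc l) (f ∘ (outside ∷_)))))
  (cong₂ _+_
    (trans (length-map (outside ∷_) (listing (suc l) (f ∘ (outside ∷_)))) (length-listing (suc l) (f ∘ (outside ∷_))))
    (trans (length-map (inside ∷_) (listing l (f ∘ (inside ∷_)))) (length-listing l (f ∘ (inside ∷_)))))

listing-unique : ∀ l (f : SetFamily n) → Unique (listing l f)
listing-unique {zero}  zero    f with f []
... | true  = [] ∷ []
... | false = []
listing-unique {zero}  (suc l) f = []
listing-unique {suc n} zero    f = Unique.map⁺ ∷-injectiveʳ (listing-unique zero (f ∘ (outside ∷_)))
listing-unique {suc n} (suc l) f = Unique.++⁺
  (Unique.map⁺ ∷-injectiveʳ (listing-unique (suc l) (f ∘ (outside ∷_))))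
  (Unique.map⁺ ∷-injectiveʳ (listing-unique l (f ∘ (inside ∷_))))
  λ (v∈out , v∈in) → disjoint (∈-map⁻ (outside ∷_) v∈out) (∈-map⁻ (inside ∷_) v∈in)
  where
  disjoint : ∀ {v : Subset (suc n)} {xs ys : List (Subset n)} {A : Set} →
    ∃[ p ] p ∈ˡ xs × v ≡ outside ∷ p → ∃[ q ] q ∈ˡ ys × v ≡ inside ∷ q → A
  disjoint (_ , _ , refl) (_ , _ , ())

∈-listing⁺ : ∀ (f : SetFamily n) v → T (f v) → v ∈ˡ listing ∣ v ∣ f
∈-listing⁺ f [] fv with f []
... | true = hereˡ refl
∈-listing⁺ f (inside ∷ v) fv = ∈-++⁺ʳ (map (outside ∷_) (listing (suc ∣ v ∣) (f ∘ (outside ∷_))))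
  (∈-map⁺ (inside ∷_) (∈-listing⁺ (f ∘ (inside ∷_)) v fv))
∈-listing⁺ f (outside ∷ v) fv with ∣ v ∣ | ∈-listing⁺ (f ∘ (outside ∷_)) v fv
... | zero  | v∈ = ∈-map⁺ (outside ∷_) v∈
... | suc _ | v∈ = ∈-++⁺ˡ (∈-map⁺ (outside ∷_) v∈)

∈-listing⁻ : ∀ l (f : SetFamily n) {v} → v ∈ˡ listing l f → ∣ v ∣ ≡ l × T (f v)
∈-listing⁻ {zero}  zero    f v∈ with f [] in eq
∈-listing⁻ {zero}  zero    f (hereˡ refl) | true = refl , subst T (sym eq) _
∈-listing⁻ {suc n} zero    f v∈ with _ , p∈ , refl ← ∈-map⁻ (outside ∷_) v∈ = ∈-listing⁻ zero (f ∘ (outside ∷_)) p∈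
∈-listing⁻ {suc n} (suc l) f v∈ with ∈-++⁻ (map (outside ∷_) (listing (suc l) (f ∘ (outside ∷_)))) v∈
... | inj₁ v∈out with _ , p∈ , refl ← ∈-map⁻ (outside ∷_) v∈out = ∈-listing⁻ (suc l) (f ∘ (outside ∷_)) p∈
... | inj₂ v∈in  with _ , p∈ , refl ← ∈-map⁻ (inside ∷_) v∈in =
  let ∣p∣≡ , fp = ∈-listing⁻ l (f ∘ (inside ∷_)) p∈ in cong suc ∣p∣≡ , fp

open module SubsetMembership {n} = DecMembership (≡-dec {n = n} Bool._≟_) using (_∈?_)

indicator : Family n k → SetFamily n
indicator 𝒜 v = ⌊ v ∈? members 𝒜 ⌋

-- Two duplicate-free lists with the same members are permutations of each other.
card≡count : (𝒜 : Family n k) → card 𝒜 ≡ count k (indicator 𝒜)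
card≡count {k = k} 𝒜 = trans
  (↭-length (∼bag⇒↭ (unique∧set⇒bag (unique 𝒜) (listing-unique k (indicator 𝒜)) (mk⇔ to from))))
  (length-listing k (indicator 𝒜))
  where
  to : ∀ {v} → v ∈ᶠ 𝒜 → v ∈ˡ listing k (indicator 𝒜)
  to {v} v∈ = subst (λ k → v ∈ˡ listing k (indicator 𝒜)) (All.lookup (uniform 𝒜) v∈)
    (∈-listing⁺ (indicator 𝒜) v (fromWitness v∈))
  from : ∀ {v} → v ∈ˡ listing k (indicator 𝒜) → v ∈ᶠ 𝒜
  from v∈ = toWitness (proj₂ (∈-listing⁻ k (indicator 𝒜) v∈))

toFamily : ∀ k → SetFamily n → Family n k
toFamily k f = record
  { members = listing k f
  ; unique  = listing-unique k f
  ; uniform = All.tabulate (proj₁ ∘ ∈-listing⁻ k f)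
  }

singleton : (K : Subset n) → ∣ K ∣ ≡ k → Family n k
singleton K ∣K∣≡k = record { members = K ∷ [] ; unique = [] ∷ [] ; uniform = ∣K∣≡k ∷ [] }

meets : Subset n → SetFamily n
meets []      []      = false
meets (x ∷ K) (y ∷ v) = (x ∧ y) ∨ meets K v

meets⇒Nonempty : ∀ (K v : Subset n) → T (meets K v) → Nonempty (K ∩ v)
meets⇒Nonempty []            []            ()
meets⇒Nonempty (inside  ∷ K) (inside  ∷ v) _ = zero , here
meets⇒Nonempty (inside  ∷ K) (outside ∷ v) t = let x , x∈ = meets⇒Nonempty K v t in suc x , there x∈
meets⇒Nonempty (outside ∷ K) (_       ∷ v) t = let x , x∈ = meets⇒Nonempty K v t in suc x , there x∈

meets-refl : ∀ (K : Subset n) → 1 ≤ ∣ K ∣ → T (meets K K)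
meets-refl (inside  ∷ K) _   = _
meets-refl (outside ∷ K) pos = meets-refl K pos

count-not-meets : ∀ (K : Subset n) l r → n ≡ ∣ K ∣ + r → count l (not ∘ meets K) ≡ r C l
count-not-meets []            zero    zero    eq = refl
count-not-meets []            (suc l) zero    eq = refl
count-not-meets (inside  ∷ K) zero    r       eq = count-not-meets K zero r (suc-injective eq)
count-not-meets {suc n} (inside ∷ K) (suc l) r eq = trans
  (cong₂ _+_ (count-not-meets K (suc l) r (suc-injective eq)) (count-const-false n l)) (+-identityʳ _)
count-not-meets (outside ∷ K) l       zero    eq =
  ⊥-elim (<⇒≢ (s≤s (∣p∣≤n K)) (sym (trans eq (+-identityʳ _))))
count-not-meets (outside ∷ K) zero    (suc r) eq =
  count-not-meets K zero r (suc-injective (trans eq (+-suc _ r)))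
count-not-meets (outside ∷ K) (suc l) (suc r) eq = trans
  (cong₂ _+_ (count-not-meets K (suc l) r n≡) (count-not-meets K l r n≡))
  (trans (+-comm (r C suc l) (r C l)) (nCk+nC[k+1]≡[n+1]C[k+1] r l))
  where n≡ = suc-injective (trans eq (+-suc _ r))

∃[∣K∣≡k] : ∀ {k n} → k ≤ n → ∃[ K ] ∣_∣ {n} K ≡ k
∃[∣K∣≡k] {k} {n} k≤n =
  let K , ∣K∣≡k , _ = count-positive⇒∃ k (const true) (subst (1 ≤_) (sym (count-const-true n k)) 1≤nCk) in K , ∣K∣≡k
  where
  1≤nCk : 1 ≤ n C k
  1≤nCk = subst (λ n → 1 ≤ n C k) (m+[n∸m]≡n k≤n) (1≤[k+j]Ck k (n ∸ k))

-- The total `x` is a parameter so that either argument of the maximum in `bound` can take its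
-- place.
record Extremal (n k t x : ℕ) : Set where
  field
    family   : Fin t → Family n k
    nonempty : ∀ i → NonEmpty (family i)
    crossing : CrossIntersecting family
    total    : totalCard family ≡ x

count-meets : ∀ {k} (K : Subset n) → ∣ K ∣ ≡ k → k ≤ n → count k (meets K) ≡ n C k ∸ (n ∸ k) C k
count-meets {n} {k} K refl k≤n = begin
  M            ≡⟨ m+n∸n≡m M M′ ⟨
  M + M′ ∸ M′  ≡⟨ cong₂ _∸_ (count-not k (meets K)) (count-not-meets K k (n ∸ k) (sym (m+[n∸m]≡n k≤n))) ⟩
  n C k ∸ (n ∸ k) C k ∎
  where
  open ≡-Reasoning
  M M′ : ℕ
  M  = count k (meets K)
  M′ = count k (not ∘ meets K)

-- One family takes every k-set meeting a fixed k-set `K`; each of the other `c` families is `K`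
-- alone. Since k ≥ 1, `K` meets itself.
all-meeting-extremal : ∀ n k c → 1 ≤ k → k ≤ n → Extremal n k (suc c) (n C k ∸ (n ∸ k) C k + c)
all-meeting-extremal n k c 1≤k k≤n with K , ∣K∣≡k ← ∃[∣K∣≡k] k≤n = record
  { family   = 𝒜
  ; nonempty = nonempty
  ; crossing = crossing
  ; total    = cong₂ _+_ (trans (length-listing k (meets K)) (count-meets K ∣K∣≡k k≤n)) (trans (sum-const c 1) (*-identityʳ c))
  }
  where
  𝒜 : Fin (suc c) → Family n k
  𝒜 zero    = toFamily k (meets K)
  𝒜 (suc _) = singleton K ∣K∣≡k
  K-meets-K : T (meets K K)
  K-meets-K = meets-refl K (subst (1 ≤_) (sym ∣K∣≡k) 1≤k)
  K∩K : Nonempty (K ∩ K)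
  K∩K = meets⇒Nonempty K K K-meets-K
  nonempty : ∀ i → NonEmpty (𝒜 i)
  nonempty zero    = K , subst (λ k → K ∈ˡ listing k (meets K)) ∣K∣≡k (∈-listing⁺ (meets K) K K-meets-K)
  nonempty (suc _) = K , hereˡ refl
  K∩ : ∀ {v} → v ∈ᶠ 𝒜 zero → Nonempty (K ∩ v)
  K∩ v∈ = meets⇒Nonempty K _ (proj₂ (∈-listing⁻ k (meets K) v∈))
  crossing : CrossIntersecting 𝒜
  crossing {zero}  {zero}  i≢j _ _ = ⊥-elim (i≢j refl)
  crossing {zero}  {suc _} {A} _ A∈ (hereˡ refl) = subst Nonempty (∩-comm K A) (K∩ A∈)
  crossing {suc _} {zero}  _ (hereˡ refl) B∈ = K∩ B∈
  crossing {suc _} {suc _} _ (hereˡ refl) (hereˡ refl) = K∩K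

star-extremal : ∀ m l t → l ≤ m → Extremal (suc m) (suc l) t (t * (m C l))
star-extremal m l t l≤m = record
  { family   = const star
  ; nonempty = λ _ → nonempty
  ; crossing = λ {_} {_} {A} {B} _ A∈ B∈ →
      head∈∩ A B (proj₂ (∈-listing⁻ (suc l) head A∈)) (proj₂ (∈-listing⁻ (suc l) head B∈))
  ; total    = trans (sum-const t (card star)) (cong (t *_) (trans (length-listing (suc l) (head {n = m}))
      (cong₂ _+_ (count-const-false m (suc l)) (count-const-true m l))))
  }
  where
  star : Family (suc m) (suc l)
  -- A side is a Boolean, so `head` is itself the predicate of containing the head point.
  star = toFamily (suc l) head
  nonempty : NonEmpty star
  nonempty with K , refl ← ∃[∣K∣≡k] l≤m = inside ∷ K , ∈-listing⁺ head (inside ∷ K) _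
  head∈∩ : ∀ (A B : Subset (suc m)) → T (head A) → T (head B) → Nonempty (A ∩ B)
  head∈∩ (inside ∷ _) (inside ∷ _) _ _ = zero , here

corollary1p5 : ∀ (n k t : ℕ) → 1 ≤ n → 1 ≤ k → 2 * k ≤ n → 2 ≤ t →
    (∀ (𝒜 : Fin t → Family n k) → (∀ i → NonEmpty (𝒜 i)) → CrossIntersecting 𝒜 →
    totalCard 𝒜 ≤ bound n k t)
    × (Σ[ 𝒜 ∈ (Fin t → Family n k) ]
    ((∀ i → NonEmpty (𝒜 i)) × CrossIntersecting 𝒜 × totalCard 𝒜 ≡ bound n k t))
corollary1p5 (suc m) (suc l) (suc (suc c)) _ _ 2k≤n (s≤s (s≤s _)) = upper , sharp
  where
  upper : ∀ 𝒜 → (∀ i → NonEmpty (𝒜 i)) → CrossIntersecting 𝒜 → totalCard 𝒜 ≤ bound (suc m) (suc l) (2 + c)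
  -- The excess `d` is n - 2k, so m = n - 1 equals l + d + (l + 1) with l = k - 1.
  upper 𝒜 nonempty crossing with d , 2k+d≡n ← m≤n⇒∃[o]m+o≡n 2k≤n =
    ≤-trans (≤-reflexive (sum-cong-≗ (card≡count ∘ 𝒜)))
      (cross-intersecting-bound l d m c (trans (sym (suc-injective 2k+d≡n)) (regroup l d)) (indicator ∘ 𝒜)
        (λ i → subst (1 ≤_) (card≡count (𝒜 i)) (positive (𝒜 i) (nonempty i)))
        (λ i≢j a b _ _ a∈ b∈ → crossing i≢j (toWitness a∈) (toWitness b∈)))
    where
    regroup : ∀ l d → l + (suc l + 0) + d ≡ l + d + suc l
    regroup = solve-∀
    positive : (ℬ : Family (suc m) (suc l)) → NonEmpty ℬ → 1 ≤ card ℬ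
    positive ℬ (_ , B∈) with members ℬ
    ... | _ ∷ _ = s≤s z≤n
  k≤n : suc l ≤ suc m
  k≤n = ≤-trans (m≤m+n (suc l) _) 2k≤n
  extremal : Extremal (suc m) (suc l) (2 + c) (bound (suc m) (suc l) (2 + c))
  extremal with ⊔-sel (suc m C suc l ∸ (m ∸ l) C suc l + suc c) ((2 + c) * (m C l))
  ... | inj₁ eq = subst (Extremal _ _ _) (sym eq) (all-meeting-extremal (suc m) (suc l) (suc c) (s≤s z≤n) k≤n)
  ... | inj₂ eq = subst (Extremal _ _ _) (sym eq) (star-extremal m l (2 + c) (s≤s⁻¹ k≤n))
  sharp : Σ[ 𝒜 ∈ (Fin (2 + c) → Family (suc m) (suc l)) ]
    ((∀ i → NonEmpty (𝒜 i)) × CrossIntersecting 𝒜 × totalCard 𝒜 ≡ bound (suc m) (suc l) (2 + c))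
  sharp = Extremal.family extremal , Extremal.nonempty extremal , Extremal.crossing extremal , Extremal.total extremal
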